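{- The only automorphisms of the monoid $\mathcal P_{\mathrm{fin},0}(\mathbb N)$ are the identity map $X \mapsto X$ and the reversion map $X \mapsto \max X - X := \{\max X - x : x \in X\}$.
   Context: $\mathbb N$ denotes the set of non-negative integers. $\mathcal P_{\mathrm{fin},0}(\mathbb N)$ (the reduced power monoid of $(\mathbb N,+)$) is the set of all finite subsets of $\mathbb N$ containing $0$, made into a commutative monoid by the sumset operation $X + Y := \{x + y : x \in X,\ y \in Y\}$; its neutral element is $\{0\}$. An automorphism is a bijective monoid homomorphism from the monoid to itself. -}

module Defs where

open import Algebra.Bundles using (CommutativeMonoid)
open import Algebra.Morphism.Structures using (module MonoidMorphisms)
open import Algebra.Structures.Biased using (isCommutativeMonoidˡ)
open import Data.List.Base using (List; [_]; map; cartesianProductWith)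
open import Data.List.Extrema.Nat using (max; argmax-sel)
open import Data.List.Membership.Propositional using (_∈_)
open import Data.List.Membership.Propositional.Properties
  using (∈-map⁺; ∈-cartesianProductWith⁺; ∈-cartesianProductWith⁻)
open import Data.List.Relation.Binary.BagAndSetEquality
  using (_∼[_]_; set; [_]-Equality)
open import Data.List.Relation.Binary.Subset.Propositional using (_⊆_)
open import Data.List.Relation.Unary.Any using (here)
open import Data.Nat.Base using (ℕ; _+_; _∸_)
open import Data.Nat.Properties using (n∸n≡0; +-comm; +-assoc)
open import Data.Product.Base using (_,_)
open import Data.Sum.Base using (inj₁; inj₂)
open import Function.Base using (id; _on_)
open import Function.Bundles using (Equivalence; mk⇔)
open import Level using (0ℓ)
open import Relation.Binary.Bundles using (Setoid)
open import Relation.Binary.Core using (Rel)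
import Relation.Binary.Construct.On as On
open import Relation.Binary.PropositionalEquality.Core using (refl; sym; subst)

-- A finite subset of ℕ is an enumeration of its elements (any order,
-- repetitions allowed), and two enumerations are identified by _≈_ when they
-- have the same members.

record Pfin₀ : Set where
  constructor mkPfin₀
  field
    elements : List ℕ
    0∈       : 0 ∈ elements

open Pfin₀ public

infix 4 _≈_

_≈_ : Rel Pfin₀ 0ℓ
_≈_ = _∼[ set ]_ on elements

infixl 6 _⊕_

_⊕_ : Pfin₀ → Pfin₀ → Pfin₀
X ⊕ Y = mkPfin₀ (cartesianProductWith _+_ (elements X) (elements Y))
                (∈-cartesianProductWith⁺ _+_ (0∈ X) (0∈ Y))

𝟘 : Pfin₀
𝟘 = mkPfin₀ [ 0 ] (here refl)

-- The base value 0 does not affect the maximum, since 0 ∈ X.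

Max : Pfin₀ → ℕ
Max X = max 0 (elements X)

Max∈ : ∀ X → Max X ∈ elements X
Max∈ X with argmax-sel id 0 (elements X)
... | inj₁ m≡0 = subst (_∈ elements X) (sym m≡0) (0∈ X)
... | inj₂ m∈X = m∈X

-- Truncated subtraction is exact here, since x ≤ Max X for every x ∈ X.

reversion : Pfin₀ → Pfin₀
reversion X = mkPfin₀ (map (Max X ∸_) (elements X))
                      (subst (_∈ map (Max X ∸_) (elements X)) (n∸n≡0 (Max X))
                             (∈-map⁺ (Max X ∸_) (Max∈ X)))

private

  ⊕-mono : ∀ X X′ Y Y′ → elements X ⊆ elements X′ → elements Y ⊆ elements Y′ →
           elements (X ⊕ Y) ⊆ elements (X′ ⊕ Y′)
  ⊕-mono X X′ Y Y′ X⊆X′ Y⊆Y′ z∈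
    with _ , _ , x∈ , y∈ , refl ← ∈-cartesianProductWith⁻ _+_ (elements X) (elements Y) z∈
    = ∈-cartesianProductWith⁺ _+_ (X⊆X′ x∈) (Y⊆Y′ y∈)

  ⊕-comm-⊆ : ∀ X Y → elements (X ⊕ Y) ⊆ elements (Y ⊕ X)
  ⊕-comm-⊆ X Y z∈
    with x , y , x∈ , y∈ , refl ← ∈-cartesianProductWith⁻ _+_ (elements X) (elements Y) z∈
    = subst (_∈ elements (Y ⊕ X)) (+-comm y x) (∈-cartesianProductWith⁺ _+_ y∈ x∈)

  ⊕-assoc-⊆ : ∀ X Y Z → elements (X ⊕ Y ⊕ Z) ⊆ elements (X ⊕ (Y ⊕ Z))
  ⊕-assoc-⊆ X Y Z w∈
    with _ , z , xy∈ , z∈ , refl ← ∈-cartesianProductWith⁻ _+_ (elements (X ⊕ Y)) (elements Z) w∈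
    with x , y , x∈ , y∈ , refl ← ∈-cartesianProductWith⁻ _+_ (elements X) (elements Y) xy∈
    = subst (_∈ elements (X ⊕ (Y ⊕ Z))) (sym (+-assoc x y z))
            (∈-cartesianProductWith⁺ _+_ x∈ (∈-cartesianProductWith⁺ _+_ y∈ z∈))

  ⊕-assoc-⊇ : ∀ X Y Z → elements (X ⊕ (Y ⊕ Z)) ⊆ elements (X ⊕ Y ⊕ Z)
  ⊕-assoc-⊇ X Y Z w∈
    with x , _ , x∈ , yz∈ , refl ← ∈-cartesianProductWith⁻ _+_ (elements X) (elements (Y ⊕ Z)) w∈
    with y , z , y∈ , z∈ , refl ← ∈-cartesianProductWith⁻ _+_ (elements Y) (elements Z) yz∈
    = subst (_∈ elements (X ⊕ Y ⊕ Z)) (+-assoc x y z)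
            (∈-cartesianProductWith⁺ _+_ (∈-cartesianProductWith⁺ _+_ x∈ y∈) z∈)

  ⊕-identityˡ-⊆ : ∀ X → elements (𝟘 ⊕ X) ⊆ elements X
  ⊕-identityˡ-⊆ X z∈
    with _ , _ , here refl , x∈ , refl ← ∈-cartesianProductWith⁻ _+_ [ 0 ] (elements X) z∈
    = x∈

commutativeMonoid : CommutativeMonoid 0ℓ 0ℓ
commutativeMonoid = record
  { Carrier = Pfin₀
  ; _≈_     = _≈_
  ; _∙_     = _⊕_
  ; ε       = 𝟘
  ; isCommutativeMonoid = isCommutativeMonoidˡ record
    { isSemigroup = record
      { isMagma = record
        { isEquivalence = On.isEquivalence elements (Setoid.isEquivalence ([ set ]-Equality ℕ))
        ; ∙-cong = λ {X} {X′} {Y} {Y′} X≈X′ Y≈Y′ → mk⇔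
            (⊕-mono X X′ Y Y′ (Equivalence.to X≈X′) (Equivalence.to Y≈Y′))
            (⊕-mono X′ X Y′ Y (Equivalence.from X≈X′) (Equivalence.from Y≈Y′))
        }
      ; assoc = λ X Y Z → mk⇔ (⊕-assoc-⊆ X Y Z) (⊕-assoc-⊇ X Y Z)
      }
    ; identityˡ = λ X → mk⇔ (⊕-identityˡ-⊆ X) (∈-cartesianProductWith⁺ _+_ (0∈ 𝟘))
    ; comm = λ X Y → mk⇔ (⊕-comm-⊆ X Y) (⊕-comm-⊆ Y X)
    }
  }

-- Bijectivity and preservation of _⊕_ and 𝟘 are all taken up to _≈_; being a
-- map of subsets rather than of enumerations (X ≈ Y implies f X ≈ f Y) is
-- included.

IsAutomorphism : (Pfin₀ → Pfin₀) → Set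
IsAutomorphism = MonoidMorphisms.IsMonoidIsomorphism rawMonoid rawMonoid
  where open CommutativeMonoid commutativeMonoid using (rawMonoid)

module Submission where

-- Up to composing with the reversion, an automorphism f fixes {0, 2, 3}. It
-- preserves maxima and fixes intervals because X + n[0, 1] = 2n[0, 1] for
-- n = max X. Write gap p R = {0} ∪ (p, R]: then X + gap p R = (X ∩ [0, p]) ∪
-- (p, R + max X] for R large, so if f fixes gap p R and this sum, then f X and
-- X agree on [0, p]. Together with the mirror image of this remark, it yields
-- by induction on p that f fixes gap p (2p + 1), hence its multiples
-- gap p (k(2p + 1)), and then by induction on the distance between the least and
-- greatest holes of X that f fixes X.

open import Defs
open import Data.Nat.Base
open import Data.Nat.Properties
open import Algebra.Bundles using (CommutativeMonoid)
import Algebra.Morphism.Construct.Identity as Identity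
open import Algebra.Morphism.Construct.Composition using (isMonoidIsomorphism)
open import Algebra.Morphism.Structures using (module MonoidMorphisms)
open import Algebra.Properties.CommutativeSemigroup +-commutativeSemigroup
  using () renaming (interchange to +-interchange)
open import Data.List.Base using (_∷_; filter; upTo)
open import Data.List.Extrema.Nat using (xs≤max)
open import Data.List.Membership.Propositional using (_∈_; _∉_)
open import Data.List.Membership.Propositional.Properties
  using (∈-map⁺; ∈-map⁻; ∈-cartesianProductWith⁺; ∈-cartesianProductWith⁻;
         ∈-filter⁺; ∈-filter⁻; ∈-upTo⁺; ∈-upTo⁻)
open import Data.List.Relation.Unary.All using (lookup)
open import Data.List.Relation.Unary.Any using (here; there)
open import Data.List.Membership.DecPropositional _≟_ using (_∈?_)
open import Data.Nat.Tactic.RingSolver using (solve-∀)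
open import Data.Product.Base using (∃-syntax; _×_; _,_; proj₁; proj₂)
open import Data.Sum.Base using (_⊎_; inj₁; inj₂; [_,_]′; map; swap)
open import Function.Base using (_∘_; case_of_)
open import Function.Bundles using (_⇔_; mk⇔; module Equivalence)
open import Relation.Binary.PropositionalEquality
  using (_≡_; _≢_; refl; sym; trans; cong; cong₂; subst; module ≡-Reasoning)
open import Relation.Nullary using (Dec; yes; no; contradiction)

open CommutativeMonoid commutativeMonoid
  using (rawMonoid; setoid)
  renaming (refl to ≈-refl; sym to ≈-sym; trans to ≈-trans; ∙-cong to ⊕-cong)
open import Algebra.Definitions.RawMonoid rawMonoid using () renaming (_×_ to _·_)
open Equivalence using (to; from)
open import Relation.Binary.Reasoning.Setoid setoid using (begin_; step-≈-⟩; step-≈-⟨; _∎)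

private variable
  x y z m n p k R : ℕ
  X Y Z : Pfin₀

-- Membership in sumsets, and maxima

∈-⊕⁺ : ∀ X Y → x ∈ elements X → y ∈ elements Y → x + y ∈ elements (X ⊕ Y)
∈-⊕⁺ X Y = ∈-cartesianProductWith⁺ _+_

∈-⊕⁻ : ∀ X Y → z ∈ elements (X ⊕ Y) →
       ∃[ x ] ∃[ y ] x ∈ elements X × y ∈ elements Y × z ≡ x + y
∈-⊕⁻ X Y = ∈-cartesianProductWith⁻ _+_ (elements X) (elements Y)

∈-⊕ˡ : ∀ X Y → z ∈ elements X → z ∈ elements (X ⊕ Y)
∈-⊕ˡ X Y z∈X = subst (_∈ elements (X ⊕ Y)) (+-identityʳ _) (∈-⊕⁺ X Y z∈X (0∈ Y))

∈-⊕ʳ : ∀ X Y → z ∈ elements Y → z ∈ elements (X ⊕ Y)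
∈-⊕ʳ X Y = ∈-⊕⁺ X Y (0∈ X)

≤Max : ∀ X → x ∈ elements X → x ≤ Max X
≤Max X = lookup (xs≤max 0 (elements X))

Max-unique : ∀ X → m ∈ elements X → (∀ {z} → z ∈ elements X → z ≤ m) → Max X ≡ m
Max-unique X m∈X bound = ≤-antisym (bound (Max∈ X)) (≤Max X m∈X)

Max-cong : ∀ X Y → X ≈ Y → Max X ≡ Max Y
Max-cong X Y X≈Y = Max-unique X (from X≈Y (Max∈ Y)) (≤Max Y ∘ to X≈Y)

Max-⊕ : ∀ X Y → Max (X ⊕ Y) ≡ Max X + Max Y
Max-⊕ X Y = Max-unique (X ⊕ Y) (∈-⊕⁺ X Y (Max∈ X) (Max∈ Y)) λ z∈ →
  case ∈-⊕⁻ X Y z∈ of λ where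
    (x , y , x∈X , y∈Y , refl) → +-mono-≤ (≤Max X x∈X) (≤Max Y y∈Y)

Max-· : ∀ k X → Max (k · X) ≡ k * Max X
Max-· zero    X = refl
Max-· (suc k) X = trans (Max-⊕ X (k · X)) (cong (Max X +_) (Max-· k X))

-- Reversion

-- The equation `z + x ≡ Max X` replaces z = Max X - x: it avoids truncated subtraction and is
-- symmetric in z and x.
∈-reversion⁺ : ∀ X → x ∈ elements X → z + x ≡ Max X → z ∈ elements (reversion X)
∈-reversion⁺ {x} {z} X x∈X eq =
  subst (_∈ elements (reversion X)) (trans (cong (_∸ x) (sym eq)) (m+n∸n≡m z x))
        (∈-map⁺ (Max X ∸_) x∈X)

∈-reversion⁻ : ∀ X → z ∈ elements (reversion X) → ∃[ x ] x ∈ elements X × z + x ≡ Max X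
∈-reversion⁻ X z∈ with x , x∈X , refl ← ∈-map⁻ (Max X ∸_) z∈ =
  x , x∈X , m∸n+n≡m (≤Max X x∈X)

∈-reversion⇒∈ : ∀ X → z ∈ elements (reversion X) → z + x ≡ Max X → x ∈ elements X
∈-reversion⇒∈ {z} X z∈ eq with y , y∈X , eq′ ← ∈-reversion⁻ X z∈ =
  subst (_∈ elements X) (+-cancelˡ-≡ z _ _ (trans eq′ (sym eq))) y∈X

Max-reversion : ∀ X → Max (reversion X) ≡ Max X
Max-reversion X =
  Max-unique (reversion X) (∈-reversion⁺ X (0∈ X) (+-identityʳ _)) λ z∈ →
    case ∈-reversion⁻ X z∈ of λ where
      (x , _ , eq) → m+n≤o⇒m≤o _ (≤-reflexive eq)

reversion-cong : ∀ X Y → X ≈ Y → reversion X ≈ reversion Y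
reversion-cong X Y X≈Y = mk⇔ (half X Y X≈Y) (half Y X (≈-sym {X} {Y} X≈Y))
  where
  half : ∀ X Y → X ≈ Y → z ∈ elements (reversion X) → z ∈ elements (reversion Y)
  half X Y X≈Y z∈ with x , x∈X , eq ← ∈-reversion⁻ X z∈ =
    ∈-reversion⁺ Y (to X≈Y x∈X) (trans eq (Max-cong X Y X≈Y))

reversion-involutive : ∀ X → reversion (reversion X) ≈ X
reversion-involutive X = mk⇔ ⊆ ⊇
  where
  ⊆ : z ∈ elements (reversion (reversion X)) → z ∈ elements X
  ⊆ z∈ with x , x∈ , eq ← ∈-reversion⁻ (reversion X) z∈ =
    ∈-reversion⇒∈ X x∈ (trans (+-comm x _) (trans eq (Max-reversion X)))
  ⊇ : z ∈ elements X → z ∈ elements (reversion (reversion X))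
  ⊇ z∈X = ∈-reversion⁺ (reversion X)
    (∈-reversion⁺ X z∈X (m∸n+n≡m (≤Max X z∈X)))
    (trans (m+[n∸m]≡n (≤Max X z∈X)) (sym (Max-reversion X)))

-- Maxima add under `_⊕_`, so reflecting x + y in Max X + Max Y reflects each summand in its own
-- maximum.
reversion-⊕ : ∀ X Y → reversion (X ⊕ Y) ≈ reversion X ⊕ reversion Y
reversion-⊕ X Y = mk⇔ ⊆ ⊇
  where
  ⊆ : z ∈ elements (reversion (X ⊕ Y)) → z ∈ elements (reversion X ⊕ reversion Y)
  ⊆ {z} z∈ with w , w∈ , eq ← ∈-reversion⁻ (X ⊕ Y) z∈
    with x , y , x∈X , y∈Y , refl ← ∈-⊕⁻ X Y w∈ =
    subst (_∈ elements (reversion X ⊕ reversion Y)) (+-cancelʳ-≡ (x + y) _ _ sum≡)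
      (∈-⊕⁺ (reversion X) (reversion Y)
        (∈-reversion⁺ X x∈X (m∸n+n≡m (≤Max X x∈X)))
        (∈-reversion⁺ Y y∈Y (m∸n+n≡m (≤Max Y y∈Y))))
    where
    sum≡ : (Max X ∸ x) + (Max Y ∸ y) + (x + y) ≡ z + (x + y)
    sum≡ = trans (+-interchange (Max X ∸ x) (Max Y ∸ y) x y)
      (trans (cong₂ _+_ (m∸n+n≡m (≤Max X x∈X)) (m∸n+n≡m (≤Max Y y∈Y)))
      (trans (sym (Max-⊕ X Y)) (sym eq)))
  ⊇ : z ∈ elements (reversion X ⊕ reversion Y) → z ∈ elements (reversion (X ⊕ Y))
  ⊇ z∈ with a , b , a∈ , b∈ , refl ← ∈-⊕⁻ (reversion X) (reversion Y) z∈
    with x , x∈X , eqx ← ∈-reversion⁻ X a∈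
    with y , y∈Y , eqy ← ∈-reversion⁻ Y b∈ =
    ∈-reversion⁺ (X ⊕ Y) (∈-⊕⁺ X Y x∈X y∈Y)
      (trans (+-interchange a b x y)
      (trans (cong₂ _+_ eqx eqy) (sym (Max-⊕ X Y))))

reversion-injective : ∀ X Y → reversion X ≈ reversion Y → X ≈ Y
reversion-injective X Y eq = begin
  X                        ≈⟨ reversion-involutive X ⟨
  reversion (reversion X)  ≈⟨ reversion-cong (reversion X) (reversion Y) eq ⟩
  reversion (reversion Y)  ≈⟨ reversion-involutive Y ⟩
  Y                        ∎

reversion-automorphism : IsAutomorphism reversion
reversion-automorphism = record
  { isMonoidMonomorphism = record
    { isMonoidHomomorphism = record
      { isMagmaHomomorphism = record
        { isRelHomomorphism = record { cong = λ {X} {Y} → reversion-cong X Y }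
        ; homo = reversion-⊕
        }
      ; ε-homo = ≈-refl {𝟘}
      }
    ; injective = λ {X} {Y} → reversion-injective X Y
    }
  ; surjective = λ Y → reversion Y , λ {Z} Z≈ →
      ≈-trans {reversion Z} {reversion (reversion Y)} {Y}
        (reversion-cong Z (reversion Y) Z≈) (reversion-involutive Y)
  }

-- Sets with a single gap

opaque
  -- For R ≤ p this is {0}, and `gap 0 n` is the interval [0, n]. Being opaque, it stays folded in
  -- membership types, so that p and R can be inferred from them.
  gap : ℕ → ℕ → Pfin₀
  gap p R = mkPfin₀ (0 ∷ filter (p <?_) (upTo (suc R))) (here refl)

  ∈-gap⁺ : p < z → z ≤ R → z ∈ elements (gap p R)
  ∈-gap⁺ {p} p<z z≤R = there (∈-filter⁺ (p <?_) (∈-upTo⁺ (s≤s z≤R)) p<z)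

  ∈-gap⁻ : z ∈ elements (gap p R) → z ≡ 0 ⊎ (p < z × z ≤ R)
  ∈-gap⁻ (here z≡0) = inj₁ z≡0
  ∈-gap⁻ {p = p} {R} (there z∈) with z∈′ , p<z ← ∈-filter⁻ (p <?_) {xs = upTo (suc R)} z∈ =
    inj₂ (p<z , s≤s⁻¹ (∈-upTo⁻ z∈′))

Max-gap : p < R → Max (gap p R) ≡ R
Max-gap {p} {R} p<R = Max-unique (gap p R) (∈-gap⁺ p<R ≤-refl) λ z∈ →
  case ∈-gap⁻ z∈ of λ where
    (inj₁ refl)      → z≤n
    (inj₂ (_ , z≤R)) → z≤R

gap-cong : ∀ p {R R′} → R ≡ R′ → gap p R ≈ gap p R′
gap-cong p {R} refl = ≈-refl {gap p R}

full≈interval : ∀ X n → Max X ≡ n → (∀ {z} → z ≤ n → z ∈ elements X) → X ≈ gap 0 n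
full≈interval X n refl full = mk⇔ ⊆ (λ z∈ → case ∈-gap⁻ z∈ of λ where
    (inj₁ refl)      → 0∈ X
    (inj₂ (_ , z≤m)) → full z≤m)
  where
  ⊆ : z ∈ elements X → z ∈ elements (gap 0 (Max X))
  ⊆ {zero}  _   = 0∈ (gap _ _)
  ⊆ {suc _} z∈X = ∈-gap⁺ z<s (≤Max X z∈X)

∈-interval : z ≤ n → z ∈ elements (gap 0 n)
∈-interval {zero}  _   = 0∈ (gap _ _)
∈-interval {suc _} z≤m = ∈-gap⁺ z<s z≤m

∈-⊕-gap⁻ : ∀ X → z ∈ elements (X ⊕ gap p R) →
           (z ≤ p × z ∈ elements X) ⊎ (p < z × z ≤ Max X + R)
∈-⊕-gap⁻ {p = p} {R} X z∈ with x , y , x∈X , y∈ , refl ← ∈-⊕⁻ X (gap p R) z∈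
  with ∈-gap⁻ y∈
... | inj₂ (p<y , y≤R) = inj₂ (≤-trans p<y (m≤n+m y x) , +-mono-≤ (≤Max X x∈X) y≤R)
... | inj₁ refl rewrite +-identityʳ x with x ≤? p
...   | yes x≤p = inj₁ (x≤p , x∈X)
...   | no  x≰p = inj₂ (≰⇒> x≰p , ≤-trans (≤Max X x∈X) (m≤m+n _ R))

-- The summand 0 of X contributes (p, R] and the summand Max X contributes (p + Max X, R + Max X];
-- as p + Max X ≤ R, no hole is left between them.
∈-⊕-gap⁺ : ∀ X → p + Max X ≤ R → p < z → z ≤ Max X + R → z ∈ elements (X ⊕ gap p R)
∈-⊕-gap⁺ {p} {R} {z} X p+m≤R p<z z≤m+R with z ≤? R
... | yes z≤R = ∈-⊕ʳ X (gap p R) (∈-gap⁺ p<z z≤R)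
... | no  z≰R = subst (_∈ elements (X ⊕ gap p R)) (m+[n∸m]≡n m≤z)
    (∈-⊕⁺ X (gap p R) (Max∈ X)
      (∈-gap⁺ (m+n≤o⇒m≤o∸n (suc p) (≤-trans (s≤s p+m≤R) (≰⇒> z≰R)))
              (m≤n+o⇒m∸n≤o z (Max X) z≤m+R)))
  where
  m≤z : Max X ≤ z
  m≤z = ≤-trans (m+n≤o⇒n≤o p p+m≤R) (<⇒≤ (≰⇒> z≰R))

-- Here X meets [0, p] in {0} only, so nothing survives in the gap. For p = 0 the condition on X is
-- vacuous and the sum is an interval.
⊕-gap : ∀ X → p + Max X ≤ R → (∀ {z} → 0 < z → z ≤ p → z ∉ elements X) →
        X ⊕ gap p R ≈ gap p (Max X + R)
⊕-gap {p} {R} X p+m≤R gapX = mk⇔ ⊆ ⊇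
  where
  ⊆ : z ∈ elements (X ⊕ gap p R) → z ∈ elements (gap p (Max X + R))
  ⊆ {z} z∈ with ∈-⊕-gap⁻ X z∈
  ⊆ {zero}  z∈ | inj₁ _             = 0∈ (gap _ _)
  ⊆ {suc z} z∈ | inj₁ (z≤p , z∈X)   = contradiction z∈X (gapX z<s z≤p)
  ⊆         z∈ | inj₂ (p<z , z≤m+R) = ∈-gap⁺ p<z z≤m+R
  ⊇ : z ∈ elements (gap p (Max X + R)) → z ∈ elements (X ⊕ gap p R)
  ⊇ z∈ with ∈-gap⁻ z∈
  ... | inj₁ refl          = 0∈ (X ⊕ gap p R)
  ... | inj₂ (p<z , z≤m+R) = ∈-⊕-gap⁺ X p+m≤R p<z z≤m+R

-- `short 0` is {0, 1}, whose multiples are the intervals, and `short 1` is {0, 2, 3}, which tells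
-- the identity from the reversion.
short : ℕ → Pfin₀
short p = gap p (suc (p + p))

Max-short : ∀ p → Max (short p) ≡ suc (p + p)
Max-short p = Max-gap (s≤s (m≤m+n p p))

1∉short-1 : 1 ∉ elements (short 1)
1∉short-1 1∈ = [ (λ ()) , (λ (1<1 , _) → <-irrefl refl 1<1) ]′ (∈-gap⁻ 1∈)

2∈short-1 : 2 ∈ elements (short 1)
2∈short-1 = ∈-gap⁺ ≤-refl (n≤1+n 2)

-- In a sum that is at most p every summand is at most p, hence 0.
·-gap : ∀ k X → (∀ {z} → 0 < z → z ≤ p → z ∉ elements X) →
        ∀ {z} → 0 < z → z ≤ p → z ∉ elements (k · X)
·-gap zero    X gapX () z≤p (here refl)
·-gap (suc k) X gapX 0<z z≤p z∈ with ∈-⊕⁻ X (k · X) z∈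
... | suc x , y , x∈ , y∈ , refl = gapX z<s (m+n≤o⇒m≤o (suc x) z≤p) x∈
... | zero  , y , x∈ , y∈ , refl = ·-gap k X gapX 0<z z≤p y∈

-- 2p + 1 is the least R for which the multiples of {0} ∪ (p, R] have no other gap.
·-short : ∀ k p → k · short p ≈ gap p (k * suc (p + p))
·-short k p = mk⇔ ⊆ (⊇ k)
  where
  ⊆ : z ∈ elements (k · short p) → z ∈ elements (gap p (k * suc (p + p)))
  ⊆ {zero}  z∈ = 0∈ (gap _ _)
  ⊆ {suc z} z∈ with suc z ≤? p
  ... | yes z≤p = contradiction z∈ (·-gap k (short p)
          (λ 0<y y≤p y∈ → [ (λ { refl → <-irrefl refl 0<y }) , (λ (p<y , _) → <⇒≱ p<y y≤p) ]′
            (∈-gap⁻ y∈)) z<s z≤p)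
  ... | no  z≰p = ∈-gap⁺ (≰⇒> z≰p) (subst (suc z ≤_)
          (trans (Max-· k (short p)) (cong (k *_) (Max-short p)))
          (≤Max (k · short p) z∈))
  ⊇ : ∀ k → z ∈ elements (gap p (k * suc (p + p))) → z ∈ elements (k · short p)
  ⊇ k z∈ with ∈-gap⁻ z∈
  ⊇ k       z∈ | inj₁ refl = 0∈ (k · short p)
  ⊇ zero    z∈ | inj₂ (p<z , z≤0) = contradiction (≤-trans p<z z≤0) λ ()
  ⊇ {z} (suc k) z∈ | inj₂ (p<z , z≤R) with z ≤? k * suc (p + p)
  ... | yes z≤ = ∈-⊕ʳ (short p) (k · short p) (⊇ k (∈-gap⁺ p<z z≤))
  ... | no  z≰ with p + k * suc (p + p) <? z
  -- The excess of z over the maximum k(2p + 1) of `k · short p` is greater than p, so it lies in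
  -- `short p`.
  ...   | yes z> = subst (_∈ elements (suc k · short p)) (m∸n+n≡m (<⇒≤ (≰⇒> z≰)))
            (∈-⊕⁺ (short p) (k · short p)
              (∈-gap⁺ (m+n≤o⇒m≤o∸n (suc p) z>)
                      (m≤n+o⇒m∸n≤o z (k * suc (p + p))
                        (subst (z ≤_) (+-comm (suc (p + p)) (k * suc (p + p))) z≤R)))
              (subst (_∈ elements (k · short p)) (trans (Max-· k (short p)) (cong (k *_) (Max-short p)))
                (Max∈ (k · short p))))
  -- The excess would now fall into the gap, so p + 1, the least nonzero element of `short p`, is
  -- split off instead. The rest exceeds p by `lower`: k = 0 contradicts p < z, and k ≥ 1 gives z ≥
  -- 2p + 2.
  ...   | no  z≯ = subst (_∈ elements (suc k · short p)) (m+[n∸m]≡n p<z)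
            (∈-⊕⁺ (short p) (k · short p) (∈-gap⁺ ≤-refl (s≤s (m≤m+n p p)))
              (⊇ k (∈-gap⁺ (lower k (≰⇒> z≰) (≮⇒≥ z≯))
                (m≤n+o⇒m∸n≤o z (suc p) (≤-trans (≮⇒≥ z≯) (n≤1+n _))))))
    where
    lower : ∀ k → k * suc (p + p) < z → z ≤ p + k * suc (p + p) → p < z ∸ suc p
    lower zero    _  z≤ = contradiction p<z (≤⇒≯ (subst (z ≤_) (+-identityʳ p) z≤))
    lower (suc k) <z _  = m+n≤o⇒m≤o∸n (suc p)
      (≤-trans (s≤s (≤-trans (≤-reflexive (+-suc p p)) (m≤m+n _ _))) <z)

∈-interval⁻ : z ∈ elements (gap 0 n) → z ≤ n
∈-interval⁻ {n = n} z∈ with ∈-gap⁻ z∈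
... | inj₁ refl          = z≤n
... | inj₂ (_ , z≤m)     = z≤m


Max-gap≤ : ∀ p R → Max (gap p R) ≤ R
Max-gap≤ p R with ∈-gap⁻ (Max∈ (gap p R))
... | inj₁ Max≡0       = ≤-trans (≤-reflexive Max≡0) z≤n
... | inj₂ (_ , Max≤R) = Max≤R

-- Automorphisms: maxima, intervals, initial segments

Fixes : (Pfin₀ → Pfin₀) → ℕ → Set
Fixes f p = f (short p) ≈ short p

Full : Pfin₀ → Set
Full X = ∀ {z} → z ≤ Max X → z ∈ elements X

module Automorphism {f : Pfin₀ → Pfin₀} (aut : IsAutomorphism f) where

  open MonoidMorphisms.IsMonoidIsomorphism aut public
    using (⟦⟧-cong; homo; ε-homo; injective; surjective)

  f-· : ∀ k X → f (k · X) ≈ k · f X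
  f-· zero    X = ε-homo
  f-· (suc k) X = begin
    f (X ⊕ k · X)    ≈⟨ homo X (k · X) ⟩
    f X ⊕ f (k · X)  ≈⟨ ⊕-cong {f X} {f X} {f (k · X)} {k · f X} (≈-refl {f X}) (f-· k X) ⟩
    f X ⊕ k · f X    ∎

  -- Max X is read off from X + n[0,1] = 2n[0,1], where n = Max X.
  Max-image : ∀ X → Max (f X) ≡ Max X * Max (f (short 0))
  Max-image X = +-cancelʳ-≡ (N * a) _ _ (begin≡
    Max (f X) + N * a                ≡⟨ cong (Max (f X) +_) (Max-· N A) ⟨
    Max (f X) + Max (N · A)          ≡⟨ Max-⊕ (f X) (N · A) ⟨
    Max (f X ⊕ N · A)                ≡⟨ Max-cong (f X ⊕ N · A) ((N + N) · A) image ⟩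
    Max ((N + N) · A)                ≡⟨ Max-· (N + N) A ⟩
    (N + N) * a                      ≡⟨ *-distribʳ-+ a N N ⟩
    N * a + N * a                    ∎≡)
    where
    open ≡-Reasoning using (step-≡-⟩; step-≡-⟨) renaming (begin_ to begin≡_; _∎ to _∎≡)
    N = Max X
    A = f (short 0)
    a = Max A
    source : X ⊕ N · short 0 ≈ (N + N) · short 0
    source = begin
      X ⊕ N · short 0
        ≈⟨ ⊕-cong {X} {X} {N · short 0} {gap 0 (N * 1)} (≈-refl {X}) (·-short N 0) ⟩
      X ⊕ gap 0 (N * 1)
        ≈⟨ ⊕-gap X (≤-reflexive (sym (*-identityʳ N))) (λ 0<z z≤0 _ → <⇒≱ 0<z z≤0) ⟩
      gap 0 (N + N * 1)
        ≈⟨ gap-cong 0 (trans (cong (_+ N * 1) (sym (*-identityʳ N))) (sym (*-distribʳ-+ 1 N N))) ⟩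
      gap 0 ((N + N) * 1) ≈⟨ ·-short (N + N) 0 ⟨
      (N + N) · short 0   ∎
    image : f X ⊕ N · A ≈ (N + N) · A
    image = begin
      f X ⊕ N · A
        ≈⟨ ⊕-cong {f X} {f X} {f (N · short 0)} {N · A} (≈-refl {f X}) (f-· N (short 0)) ⟨
      f X ⊕ f (N · short 0)   ≈⟨ homo X (N · short 0) ⟨
      f (X ⊕ N · short 0)     ≈⟨ ⟦⟧-cong {X ⊕ N · short 0} {(N + N) · short 0} source ⟩
      f ((N + N) · short 0)   ≈⟨ f-· (N + N) (short 0) ⟩
      (N + N) · A             ∎

  -- The factor in `Max-image` is 1: applied to a preimage of {0, 1}, that lemma shows that it
  -- divides 1.
  Max-f : ∀ X → Max (f X) ≡ Max X
  Max-f X with X₁ , fX₁≈ ← surjective (short 0) =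
    trans (Max-image X) (trans (cong (Max X *_) a≡1) (*-identityʳ (Max X)))
    where
    a≡1 : Max (f (short 0)) ≡ 1
    a≡1 = m*n≡1⇒n≡1 (Max X₁) _ (trans (sym (Max-image X₁))
            (trans (Max-cong (f X₁) (short 0) (fX₁≈ {X₁} (≈-refl {X₁}))) (Max-short 0)))

  fixes-gap : Fixes f p → ∀ k → f (gap p (k * suc (p + p))) ≈ gap p (k * suc (p + p))
  fixes-gap {p} fix k = begin
    f (gap p (k * suc (p + p)))  ≈⟨ ⟦⟧-cong {k · short p} {gap p (k * suc (p + p))} (·-short k p) ⟨
    f (k · short p)              ≈⟨ f-· k (short p) ⟩
    k · f (short p)              ≈⟨ ·-cong k fix ⟩
    k · short p                  ≈⟨ ·-short k p ⟩
    gap p (k * suc (p + p))      ∎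
    where
    ·-cong : ∀ k → X ≈ Y → k · X ≈ k · Y
    ·-cong         zero    eq = ≈-refl {𝟘}
    ·-cong {X} {Y} (suc k) eq = ⊕-cong {X} {Y} {k · X} {k · Y} eq (·-cong k eq)

  fixes-0 : Fixes f 0
  fixes-0 = full≈interval (f (short 0)) 1 Max≡1 full
    where
    Max≡1 : Max (f (short 0)) ≡ 1
    Max≡1 = trans (Max-f (short 0)) (Max-short 0)
    full : z ≤ 1 → z ∈ elements (f (short 0))
    full {zero}  _         = 0∈ (f (short 0))
    full {suc _} (s≤s z≤n) = subst (_∈ elements (f (short 0))) Max≡1 (Max∈ (f (short 0)))

  fixes-interval : ∀ n → f (gap 0 n) ≈ gap 0 n
  fixes-interval n = subst (λ m → f (gap 0 m) ≈ gap 0 m) (*-identityʳ n) (fixes-gap fixes-0 n)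

  ⊕-interval : ∀ X n → f (X ⊕ gap 0 n) ≈ f X ⊕ gap 0 n
  ⊕-interval X n = begin
    f (X ⊕ gap 0 n)    ≈⟨ homo X (gap 0 n) ⟩
    f X ⊕ f (gap 0 n)
      ≈⟨ ⊕-cong {f X} {f X} {f (gap 0 n)} {gap 0 n} (≈-refl {f X}) (fixes-interval n) ⟩
    f X ⊕ gap 0 n      ∎

  full-fixed : ∀ X → Full X → f X ≈ X
  full-fixed X full = begin
    f X              ≈⟨ ⟦⟧-cong {X} {gap 0 (Max X)} X≈ ⟩
    f (gap 0 (Max X)) ≈⟨ fixes-interval (Max X) ⟩
    gap 0 (Max X)    ≈⟨ X≈ ⟨
    X                ∎
    where
    X≈ : X ≈ gap 0 (Max X)
    X≈ = full≈interval X (Max X) refl full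

  -- Intervals are fixed and f is injective, so only an interval can have an interval as its image.
  -- This is how f is kept from filling a last hole.
  full-image : ∀ X → (∀ {z} → z ≤ Max X → z ∈ elements (f X)) → Full X
  full-image X full z≤ = from X≈ (∈-interval z≤)
    where
    X≈ : X ≈ gap 0 (Max X)
    X≈ = injective {X} {gap 0 (Max X)} (begin
      f X               ≈⟨ full≈interval (f X) (Max X) (Max-f X) full ⟩
      gap 0 (Max X)     ≈⟨ fixes-interval (Max X) ⟨
      f (gap 0 (Max X)) ∎)

  -- Adding {0} ∪ (p, R] erases what X contains above p and keeps X ∩ [0, p].
  agrees : Fixes f p → ∀ k X →
           f (X ⊕ gap p (k * suc (p + p))) ≈ X ⊕ gap p (k * suc (p + p)) →
           z ≤ p → z ∈ elements X ⇔ z ∈ elements (f X)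
  agrees {p} {z} fix k X fixed z≤p = mk⇔
    (λ z∈ → below (f X) (from image (∈-⊕ˡ X T z∈)))
    (λ z∈ → below X (to image (∈-⊕ˡ (f X) T z∈)))
    where
    T : Pfin₀
    T = gap p (k * suc (p + p))
    image : f X ⊕ T ≈ X ⊕ T
    image = begin
      f X ⊕ T    ≈⟨ ⊕-cong {f X} {f X} {f T} {T} (≈-refl {f X}) (fixes-gap fix k) ⟨
      f X ⊕ f T  ≈⟨ homo X T ⟨
      f (X ⊕ T)  ≈⟨ fixed ⟩
      X ⊕ T      ∎
    below : ∀ Y → z ∈ elements (Y ⊕ T) → z ∈ elements Y
    below Y z∈ with ∈-⊕-gap⁻ Y z∈
    ... | inj₁ (_ , z∈Y) = z∈Y
    ... | inj₂ (p<z , _) = contradiction z≤p (<⇒≱ p<z)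

  private
    -- With the multiplier p + m, the length R = (p + m)(2p + 1) is a multiple of 2p + 1 and still
    -- large enough for `∈-⊕-gap⁺`.
    bound : ∀ p m → p + m ≤ (p + m) * suc (p + p)
    bound p m = m≤m*n (p + m) (suc (p + p))

  -- If X contains [0, p], adding {0} ∪ (p, R] makes it an interval, which f fixes; then `agrees`
  -- applies.
  prefix-preserved : Fixes f p → ∀ X → (∀ {z} → z ≤ p → z ∈ elements X) →
                     z ≤ p → z ∈ elements (f X)
  prefix-preserved {p} fix X prefix z≤p =
    to (agrees fix K X (full-fixed (X ⊕ T) full) z≤p) (prefix z≤p)
    where
    K = p + Max X
    T = gap p (K * suc (p + p))
    full : Full (X ⊕ T)
    full {z} z≤ with z ≤? p
    ... | yes z≤p = ∈-⊕ˡ X T (prefix z≤p)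
    ... | no  z≰p = ∈-⊕-gap⁺ X (bound p (Max X)) (≰⇒> z≰p)
                      (≤-trans z≤ (≤-trans (≤-reflexive (Max-⊕ X T))
                        (+-monoʳ-≤ (Max X) (Max-gap≤ p (K * suc (p + p))))))

  -- A multiple of X brings Max X into the multiples of 2p + 1.
  gap-preserved : Fixes f p → ∀ X → (∀ {z} → 0 < z → z ≤ p → z ∉ elements X) →
                  0 < z → z ≤ p → z ∉ elements (f X)
  gap-preserved {p} {z} fix X gapX 0<z z≤p z∈ =
    -- As 0 ∈ f X, the set f X lies in P · f X = f (P · X), which agrees with P · X on [0, p].
    ·-gap P X gapX 0<z z≤p (from (agrees fix K (P · X) fixed z≤p)
      (from (f-· P X) (∈-⊕ˡ (f X) ((p + p) · f X) z∈)))
    where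
    P = suc (p + p)
    K = p + Max (P · X)
    T = gap p (K * P)
    R≡ : Max (P · X) + K * P ≡ (Max X + K) * P
    R≡ = trans (cong (_+ K * P) (trans (Max-· P X) (*-comm P (Max X))))
               (sym (*-distribʳ-+ P (Max X) K))
    sum≈ : P · X ⊕ T ≈ gap p ((Max X + K) * P)
    sum≈ = ≈-trans {P · X ⊕ T} {gap p (Max (P · X) + K * P)} {gap p ((Max X + K) * P)}
      (⊕-gap (P · X) (bound p (Max (P · X))) (·-gap P X gapX))
      (gap-cong p R≡)
    fixed : f (P · X ⊕ T) ≈ P · X ⊕ T
    fixed = begin
      f (P · X ⊕ T)               ≈⟨ ⟦⟧-cong {P · X ⊕ T} {gap p ((Max X + K) * P)} sum≈ ⟩
      f (gap p ((Max X + K) * P)) ≈⟨ fixes-gap fix (Max X + K) ⟩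
      gap p ((Max X + K) * P)     ≈⟨ sum≈ ⟨
      P · X ⊕ T                   ∎

  -- The image has maximum 3, so only 1 and 2 are in doubt. With both it would be an interval,
  -- though {0, 2, 3} is not. With neither, its sum with [0, 1] would miss 2, though {0, 2, 3} +
  -- [0, 1] = [0, 4] is fixed.
  short-1-image : f (short 1) ≈ short 1 ⊎ f (short 1) ≈ reversion (short 1)
  short-1-image = cases (1 ∈? elements fB) (2 ∈? elements fB)
    where
    B fB : Pfin₀
    B  = short 1
    fB = f B
    MaxfB : Max fB ≡ 3
    MaxfB = trans (Max-f B) (Max-short 1)
    3∈ : 3 ∈ elements fB
    3∈ = subst (_∈ elements fB) MaxfB (Max∈ fB)
    1∈B⊕ : 1 ∈ elements (B ⊕ gap 0 1)
    1∈B⊕ = ∈-⊕ʳ B (gap 0 1) (∈-interval ≤-refl)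

    B⊕-full : z ≤ 4 → z ∈ elements (B ⊕ gap 0 1)
    B⊕-full {0} _ = 0∈ (B ⊕ gap 0 1)
    B⊕-full {1} _ = 1∈B⊕
    B⊕-full {2} _ = ∈-⊕ˡ B (gap 0 1) 2∈short-1
    B⊕-full {3} _ = ∈-⊕ˡ B (gap 0 1) (∈-gap⁺ (≤ᵇ⇒≤ 2 3 _) (≤ᵇ⇒≤ 3 3 _))
    B⊕-full {4} _ = ∈-⊕⁺ B (gap 0 1) (∈-gap⁺ (≤ᵇ⇒≤ 2 3 _) (≤ᵇ⇒≤ 3 3 _)) (∈-interval ≤-refl)
    B⊕-full {suc (suc (suc (suc (suc _))))} (s≤s (s≤s (s≤s (s≤s ()))))

    MaxB⊕ : Max (B ⊕ gap 0 1) ≡ 4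
    MaxB⊕ = trans (Max-⊕ B (gap 0 1)) (cong₂ _+_ (Max-short 1) (Max-short 0))

    2∈fB⊕ : 2 ∈ elements (fB ⊕ gap 0 1)
    2∈fB⊕ = to (⊕-interval B 1) (from (full-fixed (B ⊕ gap 0 1) (λ z≤ → B⊕-full (≤-trans z≤ (≤-reflexive MaxB⊕))))
                (B⊕-full (≤ᵇ⇒≤ 2 4 _)))

    1∉∧2∉ : 1 ∉ elements fB → 2 ∉ elements fB → 2 ∉ elements (fB ⊕ gap 0 1)
    1∉∧2∉ 1∉ 2∉ 2∈ with ∈-⊕⁻ fB (gap 0 1) 2∈
    ... | 0 , _ , _  , t∈ , refl = <⇒≱ ≤-refl (∈-interval⁻ t∈)
    ... | 1 , _ , 1∈ , _  , _    = 1∉ 1∈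
    ... | 2 , _ , 2∈ , _  , _    = 2∉ 2∈
    ... | suc (suc (suc _)) , _ , _ , _ , ()

    ≈-from-cases : ∀ Y → Max Y ≡ 3 → 1 ∈ elements fB ⇔ 1 ∈ elements Y →
                   2 ∈ elements fB ⇔ 2 ∈ elements Y → fB ≈ Y
    ≈-from-cases Y MaxY≡3 e₁ e₂ = mk⇔
      (half fB Y MaxfB MaxY≡3 (to e₁) (to e₂)) (half Y fB MaxY≡3 MaxfB (from e₁) (from e₂))
      where
      half : ∀ X Y → Max X ≡ 3 → Max Y ≡ 3 → (1 ∈ elements X → 1 ∈ elements Y) →
             (2 ∈ elements X → 2 ∈ elements Y) → z ∈ elements X → z ∈ elements Y
      half {0} X Y _ _ _ _ _  = 0∈ Y
      half {1} X Y _ _ h _ z∈ = h z∈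
      half {2} X Y _ _ _ h z∈ = h z∈
      half {3} X Y _ eq _ _ _ = subst (_∈ elements Y) eq (Max∈ Y)
      half {suc (suc (suc (suc _)))} X Y eq _ _ _ z∈ =
        contradiction (subst (_ ≤_) eq (≤Max X z∈)) λ { (s≤s (s≤s (s≤s ()))) }

    both : 1 ∈ elements fB → 2 ∈ elements fB → z ≤ 3 → z ∈ elements fB
    both {0} _  _  _ = 0∈ fB
    both {1} 1∈ _  _ = 1∈
    both {2} _  2∈ _ = 2∈
    both {3} _  _  _ = 3∈
    both {suc (suc (suc (suc _)))} _ _ (s≤s (s≤s (s≤s ())))

    cases : Dec (1 ∈ elements fB) → Dec (2 ∈ elements fB) → fB ≈ B ⊎ fB ≈ reversion B
    cases (yes 1∈) (yes 2∈) = contradiction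
      (full-image B (λ z≤ → both 1∈ 2∈ (≤-trans z≤ (≤-reflexive (Max-short 1))))
        (subst (1 ≤_) (sym (Max-short 1)) (≤ᵇ⇒≤ 1 3 _))) 1∉short-1
    cases (no 1∉)  (no 2∉)  = contradiction 2∈fB⊕ (1∉∧2∉ 1∉ 2∉)
    cases (no 1∉)  (yes 2∈) = inj₁ (≈-from-cases B (Max-short 1)
      (mk⇔ (λ 1∈ → contradiction 1∈ 1∉) (λ 1∈ → contradiction 1∈ 1∉short-1)) (mk⇔ (λ _ → 2∈short-1) (λ _ → 2∈)))
    cases (yes 1∈) (no 2∉)  = inj₂ (≈-from-cases (reversion B) (trans (Max-reversion B) (Max-short 1))
      (mk⇔ (λ _ → ∈-reversion⁺ B 2∈short-1 (sym (Max-short 1))) (λ _ → 1∈))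
      (mk⇔ (λ 2∈ → contradiction 2∈ 2∉)
           (λ 2∈ → contradiction (∈-reversion⇒∈ B 2∈ (sym (Max-short 1))) 1∉short-1)))

-- Conjugation by the reversion, and the induction on p

Mirror : (f g : Pfin₀ → Pfin₀) → Set
Mirror f g = ∀ X → g (reversion X) ≈ reversion (f X)

-- Conjugating twice by the reversion returns f only up to `_≈_`; `Mirror` is a relation so that f
-- and g can nevertheless exchange roles.
Mirror-sym : ∀ {f g} → IsAutomorphism g → Mirror f g → Mirror g f
Mirror-sym {f} {g} G mirror X = begin
  f (reversion X)                          ≈⟨ reversion-involutive (f (reversion X)) ⟨
  reversion (reversion (f (reversion X)))
    ≈⟨ reversion-cong (g rrX) (reversion (f (reversion X))) (mirror (reversion X)) ⟨
  reversion (g rrX)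
    ≈⟨ reversion-cong (g rrX) (g X) (Automorphism.⟦⟧-cong G {rrX} {X} (reversion-involutive X)) ⟩
  reversion (g X)                          ∎
  where
  rrX = reversion (reversion X)

module MirroredPair {f g : Pfin₀ → Pfin₀}
  (F : IsAutomorphism f) (G : IsAutomorphism g) (mirror : Mirror f g) where

  private
    module F = Automorphism F
    module G = Automorphism G

  -- Since f preserves maxima, X and f X are reflected in the same point, so what g does near 0 is
  -- what f does near the maximum.
  reflect : ∀ X → z + x ≡ Max X →
            z ∈ elements (reversion X) ⇔ z ∈ elements (g (reversion X)) →
            x ∈ elements X ⇔ x ∈ elements (f X)
  reflect {z} {x} X eq iff = mk⇔
    (λ x∈ → ∈-reversion⇒∈ (f X) (to (mirror X) (to iff (∈-reversion⁺ X x∈ eq))) eq′)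
    (λ x∈ → ∈-reversion⇒∈ X (from iff (from (mirror X) (∈-reversion⁺ (f X) x∈ eq′))) eq)
    where
    eq′ : z + x ≡ Max (f X)
    eq′ = trans eq (sym (F.Max-f X))

  -- The mirror image of `prefix-preserved`, for the segment [Max X - p, Max X].
  suffix-preserved : Fixes g p → ∀ X → p ≤ Max X →
                     (∀ {z x} → z ≤ p → z + x ≡ Max X → x ∈ elements X) →
                     z ≤ p → z + x ≡ Max X → x ∈ elements (f X)
  suffix-preserved {p} {z} {x} fix X p≤ suffix z≤p eq =
    to (reflect X eq (mk⇔ (λ _ → G.prefix-preserved fix (reversion X) prefix z≤p) (λ _ → prefix z≤p)))
       (suffix z≤p eq)
    where
    prefix : ∀ {z} → z ≤ p → z ∈ elements (reversion X)
    prefix z≤p = ∈-reversion⁺ X (suffix z≤p (m+[n∸m]≡n z≤M)) (m+[n∸m]≡n z≤M)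
      where z≤M = ≤-trans z≤p p≤

  -- Write S = {0} ∪ [p + 2, 2p + 3]. The gap [1, p] is preserved by f and the top segment
  -- [p + 3, 2p + 3] by the mirror argument. The two undecided positions p + 1 and p + 2 are settled
  -- by adding [0, p] and [0, p + 1].
  fixes-suc : 1 ≤ p → Fixes f p → Fixes g p → Fixes f (suc p)
  fixes-suc {p} 1≤p fix fixᵍ = mk⇔ ⊆ ⊇
    where
    N = suc (suc p + suc p)
    S = short (suc p)
    fS = f S
    MaxS : Max S ≡ N
    MaxS = Max-short (suc p)
    MaxfS : Max fS ≡ N
    MaxfS = trans (F.Max-f S) MaxS

    no-small : 0 < z → z ≤ p → z ∉ elements fS
    no-small = F.gap-preserved fix S λ 0<z z≤p z∈ →
      [ (λ { refl → <-irrefl refl 0<z }) , (λ (p<z , _) → <⇒≱ p<z (m≤n⇒m≤1+n z≤p)) ]′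
        (∈-gap⁻ z∈)

    large : suc (suc p) < z → z ≤ N → z ∈ elements fS
    large {z} p+2<z z≤N =
      suffix-preserved fixᵍ S (subst (p ≤_) (sym MaxS) (m≤n⇒m≤1+n (m≤n⇒m≤1+n (m≤m+n p (suc p)))))
        (λ {u} {x} u≤p eq → ∈-gap⁺ (+-cancelˡ-≤ u _ _
            (≤-trans (≤-trans (+-monoˡ-≤ (suc (suc p)) u≤p)
              (≤-reflexive (trans (+-suc p (suc p)) refl)))
              (≤-trans (n≤1+n _) (≤-reflexive (sym (trans eq MaxS))))))
          (≤-trans (m≤n+m x u) (≤-reflexive (trans eq MaxS))))
        (m≤n+o⇒m∸n≤o N z (≤-trans (≤-reflexive (N≡ p)) (+-monoˡ-≤ p p+2<z)))
        (trans (m∸n+n≡m z≤N) (sym MaxS))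
      where
      N≡ : ∀ p → suc (suc p + suc p) ≡ suc (suc (suc p)) + p
      N≡ p = cong (suc ∘ suc) (+-suc p p)

    MaxZ : Max (S ⊕ gap 0 p) ≡ N + p
    MaxZ = trans (Max-⊕ S (gap 0 p)) (cong₂ _+_ MaxS (Max-gap 1≤p))
    shift : ∀ a → a ∈ elements fS → a ≤ z → z ≤ a + p → z ∈ elements (fS ⊕ gap 0 p)
    shift {z} a a∈ a≤z z≤ = subst (_∈ elements (fS ⊕ gap 0 p)) (m+[n∸m]≡n a≤z)
      (∈-⊕⁺ fS (gap 0 p) a∈ (∈-interval (m≤n+o⇒m∸n≤o z a z≤)))
    -- If p + 1 ∈ f S, then f S + [0, p] is an interval: 0, p + 1 and 2p + 3 yield [0, p],
    -- [p + 1, 2p + 1] and [2p + 3, 3p + 3], and 2p + 2 comes from `large`. But S + [0, p] misses p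
    -- + 1.
    image-full : suc p ∈ elements fS → z ≤ Max (S ⊕ gap 0 p) → z ∈ elements (f (S ⊕ gap 0 p))
    image-full {z} p+1∈ z≤ = from (F.⊕-interval S p) (cases (z ≤? p) (z ≤? suc p + p) (z <? N))
      where
      cases : Dec (z ≤ p) → Dec (z ≤ suc p + p) → Dec (z < N) → z ∈ elements (fS ⊕ gap 0 p)
      cases (yes z≤p) _          _         = ∈-⊕ʳ fS (gap 0 p) (∈-interval z≤p)
      cases (no z≰p)  (yes z≤2p) _         = shift (suc p) p+1∈ (≰⇒> z≰p) z≤2p
      -- Only z = 2p + 2 is left, and `large` reaches it because p ≥ 1 gives 2p + 2 ≥ p + 3.
      cases _         (no z≰2p)  (yes z<N) = ∈-⊕ˡ fS (gap 0 p)
        (large (≤-trans (s≤s (s≤s (+-monoˡ-≤ p 1≤p))) (≰⇒> z≰2p)) (<⇒≤ z<N))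
      cases _         _          (no z≮N)  = shift N (subst (_∈ elements fS) MaxfS (Max∈ fS))
        (≮⇒≥ z≮N) (≤-trans z≤ (≤-reflexive MaxZ))

    p+1∉S⊕ : suc p ∉ elements (S ⊕ gap 0 p)
    p+1∉S⊕ z∈ with x , y , x∈ , y∈ , eq ← ∈-⊕⁻ S (gap 0 p) z∈ with ∈-gap⁻ x∈
    ... | inj₁ refl        = <⇒≱ ≤-refl (subst (_≤ p) (sym eq) (∈-interval⁻ y∈))
    ... | inj₂ (p+1<x , _) = <⇒≱ p+1<x (≤-trans (m≤m+n x y) (≤-reflexive (sym eq)))

    p+1∉ : suc p ∉ elements fS
    p+1∉ p+1∈ = p+1∉S⊕ (F.full-image (S ⊕ gap 0 p) (image-full p+1∈)
      (subst (suc p ≤_) (sym MaxZ) (≤-trans (m≤n⇒m≤1+n (m≤m+n (suc p) (suc p))) (m≤m+n N p))))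

    I = gap 0 (suc p)
    full : Full (S ⊕ I)
    full {z} z≤ with z ≤? suc p | z ≤? N
    ... | yes z≤p | _       = ∈-⊕ʳ S I (∈-interval z≤p)
    ... | no z≰p  | yes z≤N = ∈-⊕ˡ S I (∈-gap⁺ (≰⇒> z≰p) z≤N)
    ... | no _    | no z≰N  = subst (_∈ elements (S ⊕ I)) (m+[n∸m]≡n (<⇒≤ (≰⇒> z≰N)))
      (∈-⊕⁺ S I (subst (_∈ elements S) MaxS (Max∈ S)) (∈-interval (m≤n+o⇒m∸n≤o z N
        (≤-trans z≤ (≤-reflexive (trans (Max-⊕ S I) (cong₂ _+_ MaxS (Max-gap {0} z<s))))))))

    -- The summand from f S is nonzero, as p + 2 is not in [0, p + 1], and [1, p + 1] misses f S; so
    -- it is p + 2 itself.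
    p+2-summand : suc (suc p) ∈ elements (fS ⊕ I) → suc (suc p) ∈ elements fS
    p+2-summand z∈ with ∈-⊕⁻ fS I z∈
    ... | zero  , _ , _ , t∈ , refl = contradiction (∈-interval⁻ t∈) (<⇒≱ ≤-refl)
    ... | suc y , t , y∈ , t∈ , eq with suc y ≤? p | suc y ≟ suc p
    ...   | yes y≤p | _        = contradiction y∈ (no-small z<s y≤p)
    ...   | no _    | yes refl = contradiction y∈ p+1∉
    ...   | no y≰p  | no y≢    = subst (_∈ elements fS)
      (≤-antisym (≤-trans (m≤m+n (suc y) t) (≤-reflexive (sym eq))) (≤∧≢⇒< (≰⇒> y≰p) (y≢ ∘ sym))) y∈

    p+2∈ : suc (suc p) ∈ elements fS
    p+2∈ = p+2-summand (to (F.⊕-interval S (suc p)) (from (F.full-fixed (S ⊕ I) full)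
      (∈-⊕ˡ S I (∈-gap⁺ ≤-refl (s≤s (s≤s (m≤m+n p (suc p))))))))

    ⊆ : z ∈ elements fS → z ∈ elements S
    ⊆ {zero}  z∈ = 0∈ S
    ⊆ {suc z} z∈ with suc z ≤? p | suc z ≟ suc p
    ... | yes z≤p | _        = contradiction z∈ (no-small z<s z≤p)
    ... | no _    | yes refl = contradiction z∈ p+1∉
    ... | no z≰p  | no z≢    = ∈-gap⁺ (≤∧≢⇒< (≰⇒> z≰p) (z≢ ∘ sym)) (subst (suc z ≤_) MaxfS (≤Max fS z∈))

    ⊇ : z ∈ elements S → z ∈ elements fS
    ⊇ {z} z∈ with ∈-gap⁻ z∈
    ... | inj₁ refl          = 0∈ fS
    ... | inj₂ (p+1<z , z≤N) with suc (suc p) ≟ z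
    ...   | yes refl = p+2∈
    ...   | no  z≢   = large (≤∧≢⇒< p+1<z z≢) z≤N

-- The data are symmetric in f and g because the final induction exchanges the two maps when it
-- works from the top of X.
record FixingPair (f g : Pfin₀ → Pfin₀) : Set where
  field
    automorphismˡ : IsAutomorphism f
    automorphismʳ : IsAutomorphism g
    mirror        : Mirror f g
    fixesˡ        : ∀ p → Fixes f p
    fixesʳ        : ∀ p → Fixes g p

FixingPair-sym : ∀ {f g} → FixingPair f g → FixingPair g f
FixingPair-sym {f} {g} pair = record
  { automorphismˡ = automorphismʳ
  ; automorphismʳ = automorphismˡ
  ; mirror        = Mirror-sym {f} {g} automorphismʳ mirror
  ; fixesˡ        = fixesʳ
  ; fixesʳ        = fixesˡ
  }
  where
  open FixingPair pair

-- Each induction step uses both maps at p, so they advance together. The case p = 1 is assumed: the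
-- reversion fixes {0, 1} but not {0, 2, 3}.
fixingPair : ∀ {f g} → IsAutomorphism f → IsAutomorphism g → Mirror f g →
             Fixes f 1 → Fixes g 1 → FixingPair f g
fixingPair {f} {g} F G mirror f1 g1 = record
  { automorphismˡ = F
  ; automorphismʳ = G
  ; mirror        = mirror
  ; fixesˡ        = λ p → proj₁ (fixes p)
  ; fixesʳ        = λ p → proj₂ (fixes p)
  }
  where
  fixes : ∀ p → Fixes f p × Fixes g p
  fixes 0 = Automorphism.fixes-0 F , Automorphism.fixes-0 G
  fixes 1 = f1 , g1
  fixes (suc (suc p)) with ff , gg ← fixes (suc p) =
    MirroredPair.fixes-suc F G mirror z<s ff gg ,
    MirroredPair.fixes-suc G F (Mirror-sym {f} {g} G mirror) z<s gg ff

-- Sets whose holes lie in a window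

HolesWithin : ℕ → ℕ → Pfin₀ → Set
HolesWithin p d X = ∀ {z} → z ≤ Max X → z ≤ p ⊎ p + d < z → z ∈ elements X

-- Adding {0} ∪ (p + d, R] fills position p + d + 1 of the window (p, p + d + 1]
-- and nothing below, and its mirror image fills p + 1 and nothing above; by
-- induction on d both sums are fixed.
holesWithin⇒fixed : ∀ {f g} → FixingPair f g → ∀ d p X → HolesWithin p d X → f X ≈ X
truncation-fixed : ∀ {f g} → FixingPair f g → ∀ d p X → p ≤ Max X → HolesWithin p (suc d) X →
                   z ≤ p + d → z ∈ elements X ⇔ z ∈ elements (f X)

truncation-fixed {z} {f} pair d p X p≤ holes z≤ =
  F.agrees (fixesˡ (p + d)) K X
    (holesWithin⇒fixed pair d p (X ⊕ T) holes⊕) z≤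
  where
  open FixingPair pair
  module F = Automorphism automorphismˡ
  K = p + d + Max X
  T = gap (p + d) (K * suc (p + d + (p + d)))
  R≥ : p + d + Max X ≤ K * suc (p + d + (p + d))
  R≥ = m≤m*n K (suc (p + d + (p + d)))
  holes⊕ : HolesWithin p d (X ⊕ T)
  holes⊕ {z} z≤M (inj₂ p+d<z) = ∈-⊕-gap⁺ X R≥ p+d<z
    (≤-trans z≤M (≤-trans (≤-reflexive (Max-⊕ X T)) (+-monoʳ-≤ (Max X) (Max-gap≤ (p + d) _))))
  -- The bound at hand is only z ≤ Max (X ⊕ T); p ≤ Max X supplies z ≤ Max X.
  holes⊕ _ (inj₁ z≤p) = ∈-⊕ˡ X T (holes (≤-trans z≤p p≤) (inj₁ z≤p))

holesWithin⇒fixed pair zero p X holes =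
  Automorphism.full-fixed (FixingPair.automorphismˡ pair) X λ {z} z≤ → holes z≤
    (case z ≤? p of λ where
      (yes z≤p) → inj₁ z≤p
      (no  z≰p) → inj₂ (subst (_< z) (sym (+-identityʳ p)) (≰⇒> z≰p)))
holesWithin⇒fixed {f} {g} pair (suc d) p X holes = cases (Max X ≤? suc (p + d))
  where
  open FixingPair pair
  module F = Automorphism automorphismˡ
  open MirroredPair automorphismˡ automorphismʳ mirror using (reflect)

  interior : suc (p + d) < Max X → f X ≈ X
  interior p+d+1<M = mk⇔
    (λ z∈ → from (agree (≤-trans (≤Max (f X) z∈) (≤-reflexive (F.Max-f X)))) z∈)
    (λ z∈ → to (agree (≤Max X z∈)) z∈)
    where
    -- The reversion carries the window (p, p + d + 1] to (q, q + d + 1].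
    q = Max X ∸ suc (suc (p + d))
    q+ : q + suc (suc (p + d)) ≡ Max X
    q+ = m∸n+n≡m p+d+1<M

    holesʳ : HolesWithin q (suc d) (reversion X)
    holesʳ {w} w≤ w-outside = ∈-reversion⁺ X
      (holes (m∸n≤m (Max X) w) (swap (map right left w-outside)))
      (m+[n∸m]≡n w≤M)
      where
      w≤M : w ≤ Max X
      w≤M = subst (w ≤_) (Max-reversion X) w≤
      right : w ≤ q → p + suc d < Max X ∸ w
      right w≤q = m+n≤o⇒m≤o∸n (suc (p + suc d))
        (≤-trans (+-monoʳ-≤ (suc (p + suc d)) w≤q)
          (≤-reflexive (trans (+-comm (suc (p + suc d)) q)
            (trans (cong (λ m → q + suc m) (+-suc p d)) q+))))
      left : q + suc d < w → Max X ∸ w ≤ p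
      left q+d+1<w = m≤n+o⇒m∸n≤o (Max X) w
        (≤-trans (≤-reflexive (trans (sym q+) (q-sum q p d))) (+-monoˡ-≤ p q+d+1<w))
        where
        q-sum : ∀ q p d → q + suc (suc (p + d)) ≡ suc (q + suc d) + p
        q-sum = solve-∀

    agree-right : suc p < z → z ≤ Max X → z ∈ elements X ⇔ z ∈ elements (f X)
    agree-right {z} p+1<z z≤M = reflect X (m∸n+n≡m z≤M)
      (truncation-fixed (FixingPair-sym pair) d q (reversion X)
        (subst (q ≤_) (sym (Max-reversion X)) (m∸n≤m (Max X) (suc (suc (p + d))))) holesʳ
        (m≤n+o⇒m∸n≤o (Max X) z
          (≤-trans (≤-reflexive (trans (sym q+) (q-sum q p d))) (+-monoˡ-≤ (q + d) p+1<z))))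
      where
      q-sum : ∀ q p d → q + suc (suc (p + d)) ≡ suc (suc p) + (q + d)
      q-sum = solve-∀

    agree-left : z ≤ p + d → z ∈ elements X ⇔ z ∈ elements (f X)
    agree-left = truncation-fixed pair d p X
      (≤-trans (≤-trans (m≤m+n p d) (n≤1+n _)) (<⇒≤ p+d+1<M)) holes

    -- The sum on the left settles [0, p + d] and its mirror image everything above p + 1, so p + 1
    -- stays open only for d = 0.
    agree-off : z ≤ Max X → z ≢ suc p → z ∈ elements X ⇔ z ∈ elements (f X)
    agree-off {z} z≤M z≢ with z ≤? p
    ... | yes z≤p = agree-left (≤-trans z≤p (m≤m+n p d))
    ... | no  z≰p = agree-right (≤∧≢⇒< (≰⇒> z≰p) (z≢ ∘ sym)) z≤M

    -- A single possible hole: f cannot fill it, since f X would be an interval.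
    agree-single : ∀ d → HolesWithin p (suc d) X →
                   (z ≤ p + d → z ∈ elements X ⇔ z ∈ elements (f X)) → z ≡ suc p → z ≤ Max X →
                   z ∈ elements X ⇔ z ∈ elements (f X)
    agree-single (suc d) _ left refl _ =
      left (≤-trans (s≤s (m≤m+n p d)) (≤-reflexive (sym (+-suc p d))))
    agree-single zero holes₁ _ refl z≤M = mk⇔
      (λ z∈ → from (F.full-fixed X (full z∈)) z∈)
      (λ z∈ → F.full-image X (image-full z∈) z≤M)
      where
      off : z ≤ Max X → z ≢ suc p → z ∈ elements X
      off {z} z≤M z≢ with z ≤? p
      ... | yes z≤p = holes₁ z≤M (inj₁ z≤p)
      ... | no  z≰p = holes₁ z≤M (inj₂ (subst (_< z) (+-comm 1 p) (≤∧≢⇒< (≰⇒> z≰p) (z≢ ∘ sym))))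
      full : suc p ∈ elements X → Full X
      full p+1∈ {z} z≤M with z ≟ suc p
      ... | yes refl = p+1∈
      ... | no  z≢   = off z≤M z≢
      image-full : suc p ∈ elements (f X) → z ≤ Max X → z ∈ elements (f X)
      image-full {z} p+1∈ z≤M with z ≟ suc p
      ... | yes refl = p+1∈
      ... | no  z≢   = to (agree-off z≤M z≢) (off z≤M z≢)

    agree : z ≤ Max X → z ∈ elements X ⇔ z ∈ elements (f X)
    agree {z} z≤M with z ≟ suc p
    ... | yes z≡ = agree-single d holes agree-left z≡ z≤M
    ... | no  z≢ = agree-off z≤M z≢

  cases : Dec (Max X ≤ suc (p + d)) → f X ≈ X
  -- A position beyond p + d that is at most Max X must be Max X, which is no hole, so the window
  -- shrinks by one.
  cases (yes M≤) = holesWithin⇒fixed pair d p X λ where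
    z≤M (inj₁ z≤p)   → holes z≤M (inj₁ z≤p)
    z≤M (inj₂ p+d<z) →
      subst (_∈ elements X) (≤-antisym (≤-trans M≤ p+d<z) z≤M) (Max∈ X)
  cases (no  M≰) = interior (≰⇒> M≰)

fixingPair⇒identity : ∀ {f g} → FixingPair f g → ∀ X → f X ≈ X
fixingPair⇒identity pair X = holesWithin⇒fixed pair (Max X) 0 X λ where
  _   (inj₁ z≤n) → 0∈ X
  z≤M (inj₂ M<z) → contradiction z≤M (<⇒≱ M<z)

-- Classification of the automorphisms

_⟫_ : ∀ {f g} → IsAutomorphism f → IsAutomorphism g → IsAutomorphism (g ∘ f)
_⟫_ = isMonoidIsomorphism {M₁ = rawMonoid} {M₂ = rawMonoid} {M₃ = rawMonoid} (λ {X} {Y} {Z} → ≈-trans {X} {Y} {Z})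

automorphism-resp-≈ : ∀ {f h} → (∀ X → f X ≈ h X) → IsAutomorphism h → IsAutomorphism f
automorphism-resp-≈ {f} {h} f≈h H = record
  { isMonoidMonomorphism = record
    { isMonoidHomomorphism = record
      { isMagmaHomomorphism = record
        { isRelHomomorphism = record { cong = λ {X} {Y} X≈Y → begin
            f X  ≈⟨ f≈h X ⟩
            h X  ≈⟨ ⟦⟧-cong {X} {Y} X≈Y ⟩
            h Y  ≈⟨ f≈h Y ⟨
            f Y  ∎ }
        ; homo = λ X Y → begin
            f (X ⊕ Y)  ≈⟨ f≈h (X ⊕ Y) ⟩
            h (X ⊕ Y)  ≈⟨ homo X Y ⟩
            h X ⊕ h Y  ≈⟨ ⊕-cong {f X} {h X} {f Y} {h Y} (f≈h X) (f≈h Y) ⟨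
            f X ⊕ f Y  ∎
        }
      ; ε-homo = ≈-trans {f 𝟘} {h 𝟘} {𝟘} (f≈h 𝟘) ε-homo
      }
    ; injective = λ {X} {Y} fX≈fY → injective {X} {Y} (begin
        h X  ≈⟨ f≈h X ⟨
        f X  ≈⟨ fX≈fY ⟩
        f Y  ≈⟨ f≈h Y ⟩
        h Y  ∎)
    }
  ; surjective = λ Y → proj₁ (surjective Y) , λ {Z} Z≈X →
      ≈-trans {f Z} {h Z} {Y} (f≈h Z) (proj₂ (surjective Y) {Z} Z≈X)
  }
  where
  open Automorphism H

-- The partner g is the conjugate of f by the reversion; it remains to see that g fixes {0, 2, 3} as
-- well.
fixes-1⇒identity : ∀ {f} → IsAutomorphism f → Fixes f 1 → ∀ X → f X ≈ X
fixes-1⇒identity {f} F f1 =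
  fixingPair⇒identity (fixingPair F G mirror f1 g1)
  where
  g : Pfin₀ → Pfin₀
  g X = reversion (f (reversion X))
  G : IsAutomorphism g
  G = (reversion-automorphism ⟫ F) ⟫ reversion-automorphism
  mirror : Mirror f g
  mirror X = reversion-cong (f (reversion (reversion X))) (f X)
    (Automorphism.⟦⟧-cong F {reversion (reversion X)} {X} (reversion-involutive X))
  B : Pfin₀
  B = short 1
  1∈rB : 1 ∈ elements (reversion B)
  1∈rB = ∈-reversion⁺ B 2∈short-1 (sym (Max-short 1))
  g1 : Fixes g 1
  g1 with Automorphism.short-1-image G
  ... | inj₁ gB≈B  = gB≈B
  -- Otherwise f would send both {0, 1, 3} and {0, 2, 3} to {0, 2, 3}, against injectivity.
  ... | inj₂ gB≈rB = contradiction (to rB≈B 1∈rB) 1∉short-1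
    where
    rB≈B : reversion B ≈ B
    rB≈B = Automorphism.injective F {reversion B} {B} (begin
      f (reversion B)  ≈⟨ reversion-injective (f (reversion B)) B gB≈rB ⟩
      B                ≈⟨ f1 ⟨
      f B              ∎)

theorem3p2 : (f : Pfin₀ → Pfin₀) →
    IsAutomorphism f ⇔ ((∀ X → f X ≈ X) ⊎ (∀ X → f X ≈ reversion X))
theorem3p2 f = mk⇔ classify
  [ (λ f≈id → automorphism-resp-≈ f≈id identity)
  , (λ f≈rev → automorphism-resp-≈ f≈rev reversion-automorphism)
  ]′
  where
  identity : IsAutomorphism (λ X → X)
  identity = Identity.isMonoidIsomorphism rawMonoid (λ {X} → ≈-refl {X})
  classify : IsAutomorphism f → (∀ X → f X ≈ X) ⊎ (∀ X → f X ≈ reversion X)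
  classify F with Automorphism.short-1-image F
  ... | inj₁ fB≈B  = inj₁ (fixes-1⇒identity F fB≈B)
  ... | inj₂ fB≈rB = inj₂ λ X → begin
    f X                          ≈⟨ reversion-involutive (f X) ⟨
    reversion (reversion (f X))  ≈⟨ reversion-cong (reversion (f X)) X (rf≈id X) ⟩
    reversion X                  ∎
    where
    -- Composing f with the reversion reduces to the case in which {0, 2, 3} is fixed.
    rf≈id : ∀ X → reversion (f X) ≈ X
    rf≈id = fixes-1⇒identity (F ⟫ reversion-automorphism) (begin
      reversion (f (short 1))          ≈⟨ reversion-cong (f (short 1)) (reversion (short 1)) fB≈rB ⟩
      reversion (reversion (short 1))  ≈⟨ reversion-involutive (short 1) ⟩
      short 1                          ∎)
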